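{- For every $n$-HCFP $\mathcal{H}$ and every formula $\varphi$ of the logic $\mathsf{E(F,X)}$ with regular atomic predicates, the set of $n$-stores satisfying $\varphi$ in $\mathcal{H}$ is regular and effectively computable (as a finite automaton) from $\mathcal{H}$ and $\varphi$.
   Context: Higher-order stores over a finite alphabet $\Gamma$: a 1-store is a sequence $[a_1\ldots a_l]$, $a_i\in\Gamma$, $l\ge0$; for $n\ge2$ an $n$-store is a nonempty sequence $[s_1\ldots s_l]$ of $(n-1)$-stores. An $n$-store is identified with its word $w(s)=[w(s_1)\ldots w(s_l)]$ over $\Gamma'=\Gamma\cup\{[,]\}$; a set of $n$-stores is regular if its set of words is accepted by a finite automaton over $\Gamma'$. Operations: on 1-stores, $\mathit{push}_1^w([a_1\ldots a_l])=[w a_2\ldots a_l]$ for $w\in\Gamma^*$ and $\mathit{top}_1([a_1\ldots a_l])=a_1$ (defined only when $l\ge1$). On $n$-stores $s=[s_1\ldots s_l]$, $n>1$: $\mathit{push}_1^w(s)=[\mathit{push}_1^w(s_1)\,s_2\ldots s_l]$; for $2\le k<n$, $\mathit{push}_k(s)=[\mathit{push}_k(s_1)\,s_2\ldots s_l]$ and $\mathit{pop}_k(s)=[\mathit{pop}_k(s_1)\,s_2\ldots s_l]$; $\mathit{push}_n(s)=[s_1 s_1 s_2\ldots s_l]$; $\mathit{pop}_n(s)=[s_2\ldots s_l]$ if $l>1$, undefined otherwise; $\mathit{top}_k(s)=\mathit{top}_k(s_1)$ for $k<n$, $\mathit{top}_n(s)=s_1$. $O_n=\{\mathit{push}_k,\mathit{pop}_k\mid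 k\in[2,n]\}\cup\{\mathit{push}_1^w\mid w\in\Gamma^*\}$. An $n$-HCFP is $\mathcal{H}=(\Gamma,\Delta)$ with $\Delta\subseteq\Gamma\times O_n$ finite; configurations are $n$-stores, and $s\hookrightarrow s'$ iff there is $(a,o)\in\Delta$ with $\mathit{top}_1(s)=a$ and $s'=o(s)$ (defined); $\overset{*}{\hookrightarrow}$ is its reflexive-transitive closure. $\mathsf{E(F,X)}$ formulas: $\varphi::=R\mid\neg\varphi\mid\varphi\wedge\varphi\mid \mathsf{EX}\,\varphi\mid\mathsf{EF}\,\varphi$, where $R$ ranges over regular sets of $n$-stores (given by finite automata). Semantics at a store $s$: $s\models R$ iff $s\in R$; Boolean connectives as usual; $s\models\mathsf{EX}\,\varphi$ iff there is $s'$ with $s\hookrightarrow s'$ and $s'\models\varphi$; $s\models\mathsf{EF}\,\varphi$ iff there is $s'$ with $s\overset{*}{\hookrightarrow}s'$ and $s'\models\varphi$. -}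

module Defs where

open import Data.Fin.Base using (Fin)
open import Data.Fin.Subset using (Subset; _∈_)
open import Data.List.Base using (List; []; _∷_; _++_; [_]; map; concatMap)
open import Data.List.Membership.Propositional using () renaming (_∈_ to _∈ˡ_)
open import Data.List.NonEmpty.Base using (List⁺; _∷_; toList)
open import Data.Maybe.Base as Maybe using (Maybe; just; nothing)
open import Data.Nat.Base using (ℕ; zero; suc; _≤_)
open import Data.Nat.Properties using (_≟_)
open import Data.Product.Base using (∃; ∃-syntax; _×_; _,_)
open import Function.Bundles using (_⇔_)
open import Level using (0ℓ)
open import Relation.Binary.Construct.Closure.ReflexiveTransitive using (Star)
open import Relation.Binary.PropositionalEquality using (_≡_)
open import Relation.Nullary using (¬_; yes; no)
open import Relation.Unary using (Pred)

record Automaton (A : Set) : Set where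
  field
    size    : ℕ
    initial : Subset size
    final   : Subset size
    δ       : Fin size → A → Subset size

  AcceptsFrom : Fin size → List A → Set
  AcceptsFrom q []      = q ∈ final
  AcceptsFrom q (a ∷ w) = ∃[ q′ ] q′ ∈ δ q a × AcceptsFrom q′ w

  Accepts : List A → Set
  Accepts w = ∃[ q ] q ∈ initial × AcceptsFrom q w

open Automaton public using (Accepts)

-- Orders start at 1: Store Γ 0 is empty.
data Store (Γ : Set) : ℕ → Set where
  base : List Γ → Store Γ 1
  nest : ∀ {n} → List⁺ (Store Γ (suc n)) → Store Γ (suc (suc n))

data Symbol (Γ : Set) : Set where
  letter : Γ → Symbol Γ
  ⟦ ⟧    : Symbol Γ

word : ∀ {Γ n} → Store Γ n → List (Symbol Γ)
word (base as)             = ⟦ ∷ map letter as ++ [ ⟧ ]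
word {n = suc _} (nest ss) = ⟦ ∷ concatMap word (toList ss) ++ [ ⟧ ]

-- The language is exactly the set of words of members of P; in particular
-- words that do not encode an n-store are rejected.
_Recognises_ : ∀ {Γ n} → Automaton (Symbol Γ) → Pred (Store Γ n) 0ℓ → Set
𝒜 Recognises P = ∀ w → Accepts 𝒜 w ⇔ (∃[ s ] word s ≡ w × P s)

-- Proof-relevant: an inhabitant carries the automaton, so a function into
-- Regular P computes one.
Regular : ∀ {Γ n} → Pred (Store Γ n) 0ℓ → Set
Regular P = ∃[ 𝒜 ] 𝒜 Recognises P

top₁ : ∀ {Γ n} → Store Γ n → Maybe Γ
top₁ (base [])       = nothing
top₁ (base (a ∷ _))  = just a
top₁ (nest (s ∷ _))  = top₁ s

-- On an empty 1-store there is no letter to replace; transitions never use this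
-- case, since they require top₁ to be defined.
push₁ : ∀ {Γ n} → List Γ → Store Γ n → Maybe (Store Γ n)
push₁ w (base [])       = nothing
push₁ w (base (_ ∷ as)) = just (base (w ++ as))
push₁ w (nest (s ∷ ss)) = Maybe.map (λ t → nest (t ∷ ss)) (push₁ w s)

-- push and pop are only used for 2 ≤ k ≤ n, where the recursion stops at order
-- k, so their clauses for base are never reached.
push : ∀ {Γ n} → ℕ → Store Γ n → Maybe (Store Γ n)
push k (base _) = nothing
push {n = n} k (nest (s ∷ ss)) with k ≟ n
... | yes _ = just (nest (s ∷ s ∷ ss))
... | no  _ = Maybe.map (λ t → nest (t ∷ ss)) (push k s)

tail : ∀ {Γ n} → List (Store Γ (suc n)) → Maybe (Store Γ (suc (suc n)))
tail []       = nothing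
tail (s ∷ ss) = just (nest (s ∷ ss))

pop : ∀ {Γ n} → ℕ → Store Γ n → Maybe (Store Γ n)
pop k (base _) = nothing
pop {n = n} k (nest (s ∷ ss)) with k ≟ n
... | yes _ = tail ss
... | no  _ = Maybe.map (λ t → nest (t ∷ ss)) (pop k s)

data Op (Γ : Set) (n : ℕ) : Set where
  push₁ᵒ : List Γ → Op Γ n
  pushᵒ  : (k : ℕ) → 2 ≤ k → k ≤ n → Op Γ n
  popᵒ   : (k : ℕ) → 2 ≤ k → k ≤ n → Op Γ n

apply : ∀ {Γ n} → Op Γ n → Store Γ n → Maybe (Store Γ n)
apply (push₁ᵒ w)    = push₁ w
apply (pushᵒ k _ _) = push k
apply (popᵒ k _ _)  = pop k

record HCFP (Γ : Set) (n : ℕ) : Set where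
  field
    Δ : List (Γ × Op Γ n)

module _ {Γ n} (H : HCFP Γ n) where
  open HCFP H

  Step : Store Γ n → Store Γ n → Set
  Step s s′ = ∃[ a ] ∃[ o ] (a , o) ∈ˡ Δ × top₁ s ≡ just a × apply o s ≡ just s′

-- A regular set of n-stores, given by an automaton all of whose accepted
-- words encode n-stores.
record RegularSet (Γ : Set) (n : ℕ) : Set where
  field
    automaton : Automaton (Symbol Γ)
    encodes   : ∀ w → Accepts automaton w → ∃[ s ] word {Γ} {n} s ≡ w

  Member : Pred (Store Γ n) 0ℓ
  Member s = Accepts automaton (word s)

data Formula (Γ : Set) (n : ℕ) : Set where
  atom  : RegularSet Γ n → Formula Γ n
  not   : Formula Γ n → Formula Γ n
  _and_ : Formula Γ n → Formula Γ n → Formula Γ n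
  EX EF : Formula Γ n → Formula Γ n

infix 4 _,_⊨_

_,_⊨_ : ∀ {Γ n} → HCFP Γ n → Store Γ n → Formula Γ n → Set
H , s ⊨ atom R    = RegularSet.Member R s
H , s ⊨ not φ     = ¬ (H , s ⊨ φ)
H , s ⊨ (φ and ψ) = (H , s ⊨ φ) × (H , s ⊨ ψ)
H , s ⊨ EX φ      = ∃[ s′ ] Step H s s′ × (H , s′ ⊨ φ)
H , s ⊨ EF φ      = ∃[ s′ ] Star (Step H) s s′ × (H , s′ ⊨ φ)

{-# OPTIONS --safe #-}
module Submission where

-- Only the top element of a store is active, so automata reading stores from
-- right to left are used. Whether s ∷ ss can reach a set P depends on s, on the
-- state q of the automaton for P on ss, and on whether ss can reach P. Since
-- there is a single control state, a push whose copy is later popped may be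
-- omitted. Hence s can be popped iff moves of lower order lead it to a store
-- allowing the pop, and otherwise the computation alternates runs of lower order
-- with pushes, each of which updates q. If q repeats, the pushes in between may
-- be omitted too, so the runs of lower order are nested to a bounded depth, and
-- induction on the order applies. At order 1 the possible outcomes for the top
-- letter form a least fixed point over a finite set.

import Data.Bool.Base as Bool
open import Data.Bool.Base using (Bool; true; false; _∧_; _∨_; T)
open import Data.Bool.Properties using (T?)
open import Data.Empty using (⊥; ⊥-elim)
open import Data.Fin.Base using (Fin)
open import Data.Fin.Properties using (any?) renaming (_≟_ to _≟ᶠ_)
open import Data.Fin.Subset using (Subset; _∈_)
open import Data.Fin.Subset.Properties using (_∈?_)
open import Data.List.Base
  using (List; []; _∷_; _++_; [_]; map; concatMap; foldr; length; lookup; null; allFin)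
open import Data.List.Membership.Propositional using (find; lose) renaming (_∈_ to _∈ˡ_)
open import Data.List.Membership.Propositional.Properties
  using (∈-map⁺; ∈-++⁺ˡ; ∈-++⁺ʳ; ∈-concatMap⁺; ∈-allFin)
open import Data.List.NonEmpty.Base using (_∷_)
open import Data.List.Properties using (++-assoc; foldr-++)
import Data.List.Relation.Unary.Any as Any
open import Data.List.Relation.Unary.Any.Properties using (lookup-index)
open import Data.List.Relation.Unary.Any using (here; there)
open import Data.Maybe.Base as Maybe using (Maybe; just; nothing)
import Data.Maybe.Properties as Maybe
import Data.Maybe.Relation.Unary.Any as MaybeAny
open import Data.Nat.Base using (ℕ; zero; suc; _≤_)
open import Data.Nat.Properties using (1+n≰n; m≤n⇒m≤1+n; ≤-refl) renaming (_≟_ to _≟ᴺ_)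
open import Data.Product.Base using (Σ; Σ-syntax; ∃-syntax; _×_; _,_; proj₂; uncurry)
open import Data.Sum.Base as Sum using (_⊎_; inj₁; inj₂; [_,_]′)
open import Data.Unit.Base using (⊤; tt)
open import Data.Vec.Base using ([]; _∷_; tabulate)
open import Data.Vec.Properties using (lookup∘tabulate; []=⇒lookup; lookup⇒[]=)
open import Function.Base using (_∘_; id; case_of_)
open import Function.Bundles using (_↔_; mk⇔; Inverse; Equivalence)
open import Level using (0ℓ)
open import Relation.Binary.Construct.Closure.ReflexiveTransitive as Star
  using (Star; ε; _◅_; _◅◅_; gmap)
open import Relation.Binary.Definitions using (DecidableEquality)
open import Relation.Binary.PropositionalEquality
  using (_≡_; _≗_; refl; sym; trans; cong; cong₂; subst)
open import Relation.Nullary using (¬_; Dec; yes; no; does)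
open import Relation.Nullary.Decidable using (map′; ¬?; _×-dec_; _⊎-dec_)
import Relation.Nullary.Decidable as Dec
open import Relation.Unary using (Pred; Decidable; _⊆_)
open import Defs

-- Finite types

-- Repetitions in the list are allowed. `index` picks one position for each element and `lookup`
-- undoes it, so equality can be decided on positions.
record Finite (A : Set) : Set where
  field
    elements : List A
    complete : ∀ x → x ∈ˡ elements

  index : A → Fin (length elements)
  index x = Any.index (complete x)

  lookup-index-complete : ∀ x → lookup elements (index x) ≡ x
  lookup-index-complete x = sym (lookup-index (complete x))

  _≟_ : DecidableEquality A
  x ≟ y = map′ (λ eq → trans (sym (lookup-index-complete x))
                             (trans (cong (lookup elements) eq) (lookup-index-complete y)))
               (cong index) (index x ≟ᶠ index y)

open Finite using (elements; complete)

finite-Bool : Finite Bool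
finite-Bool = record
  { elements = false ∷ true ∷ []
  ; complete = λ { false → here refl ; true → there (here refl) } }

finite-⊤ : Finite ⊤
finite-⊤ = record { elements = tt ∷ [] ; complete = λ _ → here refl }

finite-Maybe : ∀ {A} → Finite A → Finite (Maybe A)
finite-Maybe F = record
  { elements = nothing ∷ map just (elements F)
  ; complete = λ { nothing → here refl ; (just x) → there (∈-map⁺ just (complete F x)) } }

finite-⊎ : ∀ {A B} → Finite A → Finite B → Finite (A ⊎ B)
finite-⊎ F G = record
  { elements = map inj₁ (elements F) ++ map inj₂ (elements G)
  ; complete = λ { (inj₁ x) → ∈-++⁺ˡ (∈-map⁺ inj₁ (complete F x))
                 ; (inj₂ y) → ∈-++⁺ʳ (map inj₁ (elements F)) (∈-map⁺ inj₂ (complete G y)) } }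

finite-Σ : ∀ {A : Set} {B : A → Set} → Finite A → (∀ x → Finite (B x)) → Finite (Σ A B)
finite-Σ {A} {B} F G = record
  { elements = concatMap fibre (elements F)
  ; complete = λ (x , y) → ∈-concatMap⁺ fibre
      (lose (complete F x) (∈-map⁺ (x ,_) (complete (G x) y))) }
  where
  fibre : A → List (Σ A B)
  fibre x = map (x ,_) (elements (G x))

finite-× : ∀ {A B} → Finite A → Finite B → Finite (A × B)
finite-× F G = finite-Σ F (λ _ → G)

finite-Subset : ∀ k → Finite (Subset k)
finite-Subset zero    = record { elements = [] ∷ [] ; complete = λ { [] → here refl } }
finite-Subset (suc k) = record
  { elements = map (uncurry _∷_) (elements pairs)
  ; complete = λ { (b ∷ S) → ∈-map⁺ (uncurry _∷_) (complete pairs (b , S)) } }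
  where pairs = finite-× finite-Bool (finite-Subset k)

finite-↔ : ∀ {A m} → A ↔ Fin m → Finite A
finite-↔ {m = m} A↔m = record
  { elements = map from (allFin m)
  ; complete = λ x → subst (_∈ˡ map from (allFin m)) (strictlyInverseʳ x)
                           (∈-map⁺ from (∈-allFin (to x))) }
  where open Inverse A↔m

-- Decidable predicates as Booleans and subsets

T-does⁺ : ∀ {A : Set} (A? : Dec A) → A → T (does A?)
T-does⁺ (yes _) _ = tt
T-does⁺ (no ¬a) a = ¬a a

T-does⁻ : ∀ {A : Set} (A? : Dec A) → T (does A?) → A
T-does⁻ (yes a) _ = a

comprehension : ∀ {k} {P : Pred (Fin k) 0ℓ} → Decidable P → Subset k
comprehension P? = tabulate (λ i → does (P? i))

∈-comprehension⁺ : ∀ {k} {P : Pred (Fin k) 0ℓ} (P? : Decidable P) {i} → P i → i ∈ comprehension P?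
∈-comprehension⁺ P? {i} p = lookup⇒[]= i _ (trans (lookup∘tabulate _ i) (Dec.dec-true (P? i) p))

∈-comprehension⁻ : ∀ {k} {P : Pred (Fin k) 0ℓ} (P? : Decidable P) {i} → i ∈ comprehension P? → P i
∈-comprehension⁻ P? {i} i∈ =
  T-does⁻ (P? i) (subst T (sym (trans (sym (lookup∘tabulate _ i)) ([]=⇒lookup i∈))) tt)

-- Least pre-fixed points on finite types

module Saturation {A : Set} (F : Pred A 0ℓ → Pred A 0ℓ)
  (mono : ∀ {P Q} → P ⊆ Q → F P ⊆ F Q) (dec : ∀ {P} → Decidable P → Decidable (F P))
  (_≟_ : DecidableEquality A) where

  record Closure (U : List A) (S : Pred A 0ℓ) : Set₁ where
    field
      carrier  : Pred A 0ℓ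
      carrier? : Decidable carrier
      extends  : S ⊆ carrier
      closed   : ∀ {x} → x ∈ˡ U → F carrier x → carrier x
      least    : ∀ {P} → S ⊆ P → F P ⊆ P → carrier ⊆ P

  -- Recursion on U suffices: after closing under U, x is tested once. If x is derivable, it is
  -- added and the set is closed under U again; x is then a member already, so nothing more is
  -- required of it.
  saturate : ∀ U {S} → Decidable S → Closure U S
  saturate [] {S} S? = record
    { carrier = S ; carrier? = S? ; extends = id ; closed = λ () ; least = λ S⊆P _ → S⊆P }
  saturate (x ∷ U) {S} S? with saturate U S?
  ... | C with dec (Closure.carrier? C) x
  ...   | no ¬Fx = record
    { carrier = carrier ; carrier? = carrier? ; extends = extends ; least = least
    ; closed = λ { (here refl) Fx → ⊥-elim (¬Fx Fx) ; (there y∈U) → closed y∈U } }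
    where open Closure C
  ...   | yes Fx = record
    { carrier = D.carrier ; carrier? = D.carrier?
    ; extends = D.extends ∘ inj₁ ∘ extends
    ; closed = λ { (here refl) _ → D.extends (inj₂ refl) ; (there y∈U) → D.closed y∈U }
    ; least = λ {P} S⊆P FP⊆P →
        D.least (λ { (inj₁ c) → least S⊆P FP⊆P c
                   -- P contains the first closure, so monotonicity puts x into P as well.
                   ; (inj₂ refl) → FP⊆P (mono (least S⊆P FP⊆P) Fx) }) FP⊆P }
    where
    open Closure C
    module D = Closure (saturate U (λ y → carrier? y ⊎-dec (y ≟ x)))

-- Functions computed by nested automata

-- Automata run from right to left, so that the state reached on the tail of a
-- store is what remains unchanged while the top element is rewritten. At order
-- n + 2 the letters are (n + 1)-stores, and each function step q is itself
-- computed by an automaton of order n + 1.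
data Finitary {Γ : Set} {K : Set} : ∀ {n} → (Store Γ n → K) → Set₁ where
  base : ∀ {Q : Set} {f : Store Γ 1 → K} → Finite Q →
    (run : List Γ → Q) (step : Q → Γ → Q) → (∀ a as → run (a ∷ as) ≡ step (run as) a) →
    (out : Q → K) → (∀ as → f (base as) ≡ out (run as)) → Finitary f
  nest : ∀ {n} {Q : Set} {f : Store Γ (suc (suc n)) → K} → Finite Q →
    (run : List (Store Γ (suc n)) → Q) (step : Q → Store Γ (suc n) → Q) →
    (∀ s ss → run (s ∷ ss) ≡ step (run ss) s) → (∀ q → Finitary (step q)) →
    (out : Q → K) → (∀ s ss → f (nest (s ∷ ss)) ≡ out (run (s ∷ ss))) → Finitary f

-- Closure properties of finitary functions and recognisable predicates

module _ {Γ : Set} where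

  finitary-cong : ∀ {K n} {f g : Store Γ n → K} → f ≗ g → Finitary f → Finitary g
  finitary-cong f≗g (base F run step run-∷ out f≡) =
    base F run step run-∷ out (λ as → trans (sym (f≗g _)) (f≡ as))
  finitary-cong f≗g (nest F run step run-∷ fin out f≡) =
    nest F run step run-∷ fin out (λ s ss → trans (sym (f≗g _)) (f≡ s ss))

  finitary-∘ : ∀ {K L n} (g : K → L) {f : Store Γ n → K} → Finitary f → Finitary (g ∘ f)
  finitary-∘ g (base F run step run-∷ out f≡) =
    base F run step run-∷ (g ∘ out) (λ as → cong g (f≡ as))
  finitary-∘ g (nest F run step run-∷ fin out f≡) =
    nest F run step run-∷ fin (g ∘ out) (λ s ss → cong g (f≡ s ss))

  finitary-, : ∀ {K L n} {f : Store Γ n → K} {g : Store Γ n → L} →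
    Finitary f → Finitary g → Finitary (λ s → f s , g s)
  finitary-, (base F run step run-∷ out f≡) (base F′ run′ step′ run′-∷ out′ g≡) =
    base (finite-× F F′) (λ as → run as , run′ as) (λ (q , q′) a → step q a , step′ q′ a)
      (λ a as → cong₂ _,_ (run-∷ a as) (run′-∷ a as))
      (λ (q , q′) → out q , out′ q′) (λ as → cong₂ _,_ (f≡ as) (g≡ as))
  finitary-, (nest F run step run-∷ fin out f≡) (nest F′ run′ step′ run′-∷ fin′ out′ g≡) =
    nest (finite-× F F′) (λ ss → run ss , run′ ss) (λ (q , q′) s → step q s , step′ q′ s)
      (λ s ss → cong₂ _,_ (run-∷ s ss) (run′-∷ s ss))
      (λ (q , q′) → finitary-, (fin q) (fin′ q′))
      (λ (q , q′) → out q , out′ q′) (λ s ss → cong₂ _,_ (f≡ s ss) (g≡ s ss))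

  finitary-const : ∀ {K n} (k : K) → Finitary {n = suc n} (λ (_ : Store Γ (suc n)) → k)
  finitary-const {n = zero}  k =
    base finite-⊤ _ _ (λ _ _ → refl) (λ _ → k) (λ _ → refl)
  finitary-const {n = suc _} k =
    nest finite-⊤ _ _ (λ _ _ → refl) (λ _ → finitary-const tt) (λ _ → k) (λ _ _ → refl)

  -- From right to left the top letter comes last, so the state remembers the latest letter and
  -- every step forgets the previous one.
  finitary-top₁ : Finite Γ → ∀ {n} → Finitary (top₁ {Γ} {suc n})
  finitary-top₁ F {zero} =
    base (finite-Maybe F) (top₁ ∘ base) (λ _ → just) (λ _ _ → refl) id (λ _ → refl)
  finitary-top₁ F {suc n} =
    nest (finite-Maybe F) first (λ _ → top₁) (λ _ _ → refl) (λ _ → finitary-top₁ F) id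
      (λ _ _ → refl)
    where
    first : List (Store Γ (suc n)) → Maybe Γ
    first []      = nothing
    first (s ∷ _) = top₁ s

  -- The automaton computes only the Boolean part of the decision. `does` commutes definitionally
  -- with the combinators on decisions, so the Boolean connectives need no transport.
  record Recognisable {n : ℕ} (P : Pred (Store Γ n) 0ℓ) : Set₁ where
    constructor recognised
    field
      decide   : Decidable P
      finitary : Finitary (λ s → does (decide s))


  recognisable-⇔ : ∀ {n} {P Q : Pred (Store Γ n) 0ℓ} → P ⊆ Q → Q ⊆ P →
    Recognisable P → Recognisable Q
  recognisable-⇔ P⊆Q Q⊆P (recognised P? fin) = recognised (λ s → map′ P⊆Q Q⊆P (P? s)) fin

  recognisable-∁ : ∀ {n} {P : Pred (Store Γ n) 0ℓ} →
    Recognisable P → Recognisable (λ s → ¬ P s)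
  recognisable-∁ (recognised P? fin) = recognised (λ s → ¬? (P? s)) (finitary-∘ Bool.not fin)

  recognisable-∩ : ∀ {n} {P Q : Pred (Store Γ n) 0ℓ} →
    Recognisable P → Recognisable Q → Recognisable (λ s → P s × Q s)
  recognisable-∩ (recognised P? fin) (recognised Q? fin′) =
    recognised (λ s → P? s ×-dec Q? s) (finitary-∘ (uncurry _∧_) (finitary-, fin fin′))

  recognisable-∪ : ∀ {n} {P Q : Pred (Store Γ n) 0ℓ} →
    Recognisable P → Recognisable Q → Recognisable (λ s → P s ⊎ Q s)
  recognisable-∪ (recognised P? fin) (recognised Q? fin′) =
    recognised (λ s → P? s ⊎-dec Q? s) (finitary-∘ (uncurry _∨_) (finitary-, fin fin′))

  recognisable-preimage : ∀ {K : Set} {n} {f : Store Γ n → K} → Finitary f →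
    {P : Pred K 0ℓ} → Decidable P → Recognisable (λ s → P (f s))
  recognisable-preimage fin P? = recognised (λ s → P? _) (finitary-∘ (λ k → does (P? k)) fin)

  recognisable-Any : ∀ {A : Set} {n} {P : A → Pred (Store Γ (suc n)) 0ℓ} →
    (∀ x → Recognisable (P x)) → ∀ xs → Recognisable (λ s → Any.Any (λ x → P x s) xs)
  recognisable-Any rec []       = recognised (λ _ → no λ ()) (finitary-const false)
  recognisable-Any rec (x ∷ xs) =
    recognisable-⇔ Any.fromSum Any.toSum (recognisable-∪ (rec x) (recognisable-Any rec xs))

  recognisable-∃ : ∀ {A : Set} {n} {P : A → Pred (Store Γ (suc n)) 0ℓ} → Finite A →
    (∀ x → Recognisable (P x)) → Recognisable (λ s → ∃[ x ] P x s)
  recognisable-∃ F rec = recognisable-⇔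
    (λ any → let x , _ , p = find any in x , p) (λ (x , p) → lose (complete F x) p)
    (recognisable-Any rec (elements F))

  -- From automata on words to nested automata

  -- The start state q is arbitrary because an inner store is read from whatever state the word to
  -- its right leaves. `run` includes the closing bracket of the store, and `out` reads the opening
  -- one.
  finitary-word : ∀ {Q : Set} → Finite Q → (δ : Symbol Γ → Q → Q) → ∀ {n} (q : Q) →
    Finitary {n = suc n} (λ s → foldr δ q (word s))
  finitary-word F δ {zero} q =
    base F (λ as → foldr δ q (map letter as ++ [ ⟧ ])) (λ p a → δ (letter a) p)
      (λ _ _ → refl) (δ ⟦) (λ _ → refl)
  finitary-word F δ {suc n} q =
    nest F (λ ss → foldr δ q (concatMap word ss ++ [ ⟧ ])) (λ p s → foldr δ p (word s))
      (λ s ss → trans (cong (foldr δ q) (++-assoc (word s) (concatMap word ss) [ ⟧ ]))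
                      (foldr-++ δ q (word s) _))
      (λ p → finitary-word F δ p) (δ ⟦) (λ _ _ → refl)

open Recognisable

module _ {Γ : Set} (𝒜 : Automaton Γ) where
  open Automaton 𝒜 hiding (Accepts)

  predecessor? : ∀ a (S : Subset size) → Decidable (λ q → ∃[ q′ ] q′ ∈ δ q a × q′ ∈ S)
  predecessor? a S q = any? (λ q′ → (q′ ∈? δ q a) ×-dec (q′ ∈? S))

  -- The subset construction run from the right: folded over a word it yields the states from which
  -- the word is accepted, and it is deterministic.
  predecessors : Γ → Subset size → Subset size
  predecessors a S = comprehension (predecessor? a S)

  acceptsFrom⇒∈ : ∀ w {q} → AcceptsFrom q w → q ∈ foldr predecessors final w
  acceptsFrom⇒∈ []      q∈ = q∈
  acceptsFrom⇒∈ (a ∷ w) (q′ , q′∈ , acc) =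
    ∈-comprehension⁺ (predecessor? a _) (q′ , q′∈ , acceptsFrom⇒∈ w acc)

  ∈⇒acceptsFrom : ∀ w {q} → q ∈ foldr predecessors final w → AcceptsFrom q w
  ∈⇒acceptsFrom []      q∈ = q∈
  ∈⇒acceptsFrom (a ∷ w) q∈ =
    let q′ , q′∈ , q′∈w = ∈-comprehension⁻ (predecessor? a _) q∈
    in q′ , q′∈ , ∈⇒acceptsFrom w q′∈w

recognisable-accepts : ∀ {Γ n} (𝒜 : Automaton (Symbol Γ)) →
  Recognisable {Γ} {suc n} (λ s → Accepts 𝒜 (word s))
recognisable-accepts 𝒜 = recognisable-⇔
  (λ {s} (q , q∈ , q∈w) → q , q∈ , ∈⇒acceptsFrom 𝒜 (word s) q∈w)
  (λ {s} (q , q∈ , acc) → q , q∈ , acceptsFrom⇒∈ 𝒜 (word s) acc)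
  (recognisable-preimage (finitary-word (finite-Subset size) (predecessors 𝒜) final)
    (λ S → any? (λ q → (q ∈? initial) ×-dec (q ∈? S))))
  where open Automaton 𝒜

-- From nested automata to automata on words

module _ {Γ : Set} where

  -- The state between two letters of an order-(n + 2) automaton, with a flag
  -- recording whether some element has been read, or a pending letter being read.
  State : ∀ {K n} {f : Store Γ n → K} → Finitary f → Set
  State (base {Q} _ _ _ _ _ _)         = Q
  State (nest {Q = Q} _ _ _ _ fin _ _) = (Q × Bool) ⊎ (Σ[ q ∈ Q ] State (fin q))

  finite-State : ∀ {K n} {f : Store Γ n → K} (r : Finitary f) → Finite (State r)
  finite-State (base F _ _ _ _ _)       = F
  finite-State (nest F _ _ _ fin _ _) =
    finite-⊎ (finite-× F finite-Bool) (finite-Σ F (λ q → finite-State (fin q)))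

  enter : ∀ {K n} {f : Store Γ n → K} (r : Finitary f) → State r
  enter (base _ run _ _ _ _)   = run []
  enter (nest _ run _ _ _ _ _) = inj₁ (run [] , false)

  resume : ∀ {Q : Set} {X : Q → Set} (q : Q) → X q ⊎ Q → (Q × Bool) ⊎ Σ Q X
  resume q (inj₁ x)  = inj₂ (q , x)
  resume q (inj₂ q′) = inj₁ (q′ , true)

  -- Reading starts just after the last closing bracket of the store. `inj₂` delivers the value of f
  -- at its first bracket; `nothing` rejects. The flag excludes empty sequences at higher orders.
  scan : ∀ {K n} {f : Store Γ n → K} (r : Finitary f) → State r → Symbol Γ → Maybe (State r ⊎ K)
  scan (base _ _ step _ _ _)    q                 (letter a) = just (inj₁ (step q a))
  scan (base _ _ _ _ out _)     q                 ⟦          = just (inj₂ (out q))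
  scan (base _ _ _ _ _ _)       q                 ⟧          = nothing
  scan (nest _ _ _ _ _ _ _)     (inj₁ _)          (letter _) = nothing
  scan (nest _ _ _ _ _ out _)   (inj₁ (q , true))  ⟦         = just (inj₂ (out q))
  scan (nest _ _ _ _ _ _ _)     (inj₁ (q , false)) ⟦         = nothing
  scan (nest _ _ _ _ fin _ _)   (inj₁ (q , _))    ⟧          =
    just (inj₁ (inj₂ (q , enter (fin q))))
  scan (nest _ _ _ _ fin _ _)   (inj₂ (q , x))    c          =
    Maybe.map (inj₁ ∘ resume q) (scan (fin q) x c)

  -- The invariant of the scan, w being the suffix read so far. In the pending case v is the part of
  -- it that belongs to the unfinished inner store.
  Describes : ∀ {K n} {f : Store Γ n → K} (r : Finitary f) → State r → List (Symbol Γ) → Set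
  Describes (base _ run _ _ _ _) q w =
    ∃[ as ] w ≡ map letter as ++ [ ⟧ ] × run as ≡ q
  Describes (nest _ run _ _ _ _ _) (inj₁ (q , b)) w =
    ∃[ ss ] w ≡ concatMap word ss ++ [ ⟧ ] × run ss ≡ q × b ≡ Bool.not (null ss)
  Describes (nest _ run _ _ fin _ _) (inj₂ (q , x)) w =
    ∃[ ss ] ∃[ v ] w ≡ v ++ concatMap word ss ++ [ ⟧ ] × run ss ≡ q × Describes (fin q) x v

  Outcome : ∀ {K n} {f : Store Γ n → K} (r : Finitary f) → State r ⊎ K → List (Symbol Γ) → Set
  Outcome         r (inj₁ x) w = Describes r x w
  Outcome {f = f} r (inj₂ k) w = ∃[ s ] word s ≡ w × f s ≡ k

  describes-enter : ∀ {K n} {f : Store Γ n → K} (r : Finitary f) → Describes r (enter r) [ ⟧ ]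
  describes-enter (base _ _ _ _ _ _)   = [] , refl , refl
  describes-enter (nest _ _ _ _ _ _ _) = [] , refl , refl , refl

  scan-sound : ∀ {K n} {f : Store Γ n → K} (r : Finitary f) x c {w y} →
    Describes r x w → scan r x c ≡ just y → Outcome r y (c ∷ w)
  scan-sound (base _ _ _ run-∷ _ _) q (letter a) (as , refl , refl) refl =
    a ∷ as , refl , run-∷ a as
  scan-sound (base _ _ _ _ _ f≡) q ⟦ (as , refl , refl) refl = base as , refl , f≡ as
  scan-sound (nest _ _ _ _ _ _ f≡) (inj₁ (q , true)) ⟦ (s ∷ ss , refl , refl , _) refl =
    nest (s ∷ ss) , refl , f≡ s ss
  scan-sound (nest _ _ _ _ fin _ _) (inj₁ (q , _)) ⟧ (ss , refl , refl , _) refl =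
    ss , [ ⟧ ] , refl , refl , describes-enter (fin q)
  scan-sound (nest _ _ _ run-∷ fin _ _) (inj₂ (q , x)) c (ss , v , refl , refl , d) eq
    with scan (fin q) x c in eq′
  scan-sound (nest _ _ _ run-∷ fin _ _) (inj₂ (q , x)) c (ss , v , refl , refl , d) refl
    | just (inj₁ y) = ss , c ∷ v , refl , refl , scan-sound (fin q) x c d eq′
  scan-sound (nest _ _ _ run-∷ fin _ _) (inj₂ (q , x)) c (ss , v , refl , refl , d) refl
    | just (inj₂ k) with s , s≡ , refl ← scan-sound (fin q) x c d eq′ =
    s ∷ ss
    , trans (cong (_++ (concatMap word ss ++ [ ⟧ ])) (sym s≡))
            (sym (++-assoc (word s) (concatMap word ss) [ ⟧ ]))
    , run-∷ s ss , refl

  data Reads {K : Set} {n : ℕ} {f : Store Γ n → K} (r : Finitary f) :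
      List (Symbol Γ) → State r → Set where
    start : Reads r [ ⟧ ] (enter r)
    next  : ∀ {w x y} c → Reads r w x → scan r x c ≡ just (inj₁ y) → Reads r (c ∷ w) y

  module _ {K : Set} {n : ℕ} {Q : Set} {f : Store Γ (suc (suc n)) → K} (F : Finite Q)
    (run : List (Store Γ (suc n)) → Q) (step : Q → Store Γ (suc n) → Q)
    (run-∷ : ∀ s ss → run (s ∷ ss) ≡ step (run ss) s) (fin : ∀ q → Finitary (step q))
    (out : Q → K) (f≡ : ∀ s ss → f (nest (s ∷ ss)) ≡ out (run (s ∷ ss))) where

    private
      r : Finitary f
      r = nest F run step run-∷ fin out f≡

    -- While a letter is pending, the outer automaton imitates the inner one; the closing bracket
    -- that opens the letter is one extra step.
    reads-pending : ∀ {q b u v x} → Reads r u (inj₁ (q , b)) → Reads (fin q) v x →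
      Reads r (v ++ u) (inj₂ (q , x))
    reads-pending {b = false} R start = next ⟧ R refl
    reads-pending {b = true}  R start = next ⟧ R refl
    reads-pending {q} R (next c R′ eq) =
      next c (reads-pending R R′) (cong (Maybe.map (inj₁ ∘ resume q)) eq)

  scan-complete : ∀ {K n} {f : Store Γ n → K} (r : Finitary f) (s : Store Γ n) →
    ∃[ w ] ∃[ x ] word s ≡ ⟦ ∷ w × Reads r w x × scan r x ⟦ ≡ just (inj₂ (f s))
  scan-complete r@(base _ run step run-∷ out f≡) (base as) =
    _ , run as , refl , reads as , cong (just ∘ inj₂) (sym (f≡ as))
    where
    reads : ∀ as → Reads r (map letter as ++ [ ⟧ ]) (run as)
    reads []       = start
    reads (a ∷ as) = next (letter a) (reads as) (cong (just ∘ inj₁) (sym (run-∷ a as)))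
  scan-complete r@(nest F run step run-∷ fin out f≡) (nest (s ∷ ss)) =
    _ , inj₁ (run (s ∷ ss) , true) , refl , reads (s ∷ ss) , cong (just ∘ inj₂) (sym (f≡ s ss))
    where
    reads : ∀ ss → Reads r (concatMap word ss ++ [ ⟧ ]) (inj₁ (run ss , Bool.not (null ss)))
    reads []       = start
    reads (s ∷ ss) with w , x , s≡ , R , eq ← scan-complete (fin (run ss)) s =
      subst (λ v → Reads r v _)
        (trans (cong (_++ (concatMap word ss ++ [ ⟧ ])) (sym s≡))
               (sym (++-assoc (word s) (concatMap word ss) [ ⟧ ])))
        (next ⟦ (reads-pending F run step run-∷ fin out f≡ (reads ss) R)
          (trans (cong (Maybe.map (inj₁ ∘ resume (run ss))) eq)
                 (cong (λ q → just (inj₁ (inj₁ (q , true)))) (sym (run-∷ s ss)))))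

-- Reversing a partial right-to-left automaton

module Reversal {A S : Set} (F : Finite S) (start done : S) (run : S → A → Maybe S) where
  open Finite F using (index; lookup-index-complete; _≟_)

  Trace : List A → S → Set
  Trace []      q = q ≡ start
  Trace (a ∷ w) q = ∃[ p ] Trace w p × run p a ≡ just q

  private
    size : ℕ
    size = length (elements F)

    decode : Fin size → S
    decode = lookup (elements F)

    edge? : ∀ i a → Decidable (λ j → run (decode j) a ≡ just (decode i))
    edge? i a j = Maybe.≡-dec _≟_ (run (decode j) a) (just (decode i))

  -- All arrows are turned round, so reading begins at `done`, ends at `start`, and each transition
  -- guesses the state that the right-to-left run had before the letter.
  automaton : Automaton A
  automaton = record
    { size    = size
    ; initial = comprehension (λ i → decode i ≟ done)
    ; final   = comprehension (λ i → decode i ≟ start)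
    ; δ       = λ i a → comprehension (edge? i a)
    }

  open Automaton automaton using (AcceptsFrom)

  acceptsFrom⇒trace : ∀ w {i} → AcceptsFrom i w → Trace w (decode i)
  acceptsFrom⇒trace []      i∈ = ∈-comprehension⁻ (λ i → decode i ≟ start) i∈
  acceptsFrom⇒trace (a ∷ w) {i} (j , j∈ , acc) =
    decode j , acceptsFrom⇒trace w acc , ∈-comprehension⁻ (edge? i a) j∈

  trace⇒acceptsFrom : ∀ w {i} → Trace w (decode i) → AcceptsFrom i w
  trace⇒acceptsFrom []      t = ∈-comprehension⁺ (λ i → decode i ≟ start) t
  trace⇒acceptsFrom (a ∷ w) {i} (p , t , eq) =
    -- Several positions may decode to p; any of them has the same edges.
    index p
    , ∈-comprehension⁺ (edge? i a) (subst (λ p → run p a ≡ just (decode i)) p≡ eq)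
    , trace⇒acceptsFrom w (subst (Trace w) p≡ t)
    where p≡ = sym (lookup-index-complete p)

  accepts⇒trace : ∀ w → Accepts automaton w → Trace w done
  accepts⇒trace w (i , i∈ , acc) =
    subst (Trace w) (∈-comprehension⁻ (λ i → decode i ≟ done) i∈) (acceptsFrom⇒trace w acc)

  trace⇒accepts : ∀ w → Trace w done → Accepts automaton w
  trace⇒accepts w t =
    index done
    , ∈-comprehension⁺ (λ i → decode i ≟ done) (lookup-index-complete done)
    , trace⇒acceptsFrom w (subst (Trace w) (sym (lookup-index-complete done)) t)

-- `outside` precedes the last bracket of the word and `accepted` follows its first one. No letter
-- leads out of `accepted`, so nothing may stand to the left of the store.
data Phase (S : Set) : Set where
  outside accepted : Phase S
  inside : S → Phase S

finite-Phase : ∀ {S} → Finite S → Finite (Phase S)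
finite-Phase F = record
  { elements = outside ∷ accepted ∷ map inside (elements F)
  ; complete = λ { outside → here refl ; accepted → there (here refl)
                 ; (inside x) → there (there (∈-map⁺ inside (complete F x))) } }

module _ {Γ : Set} {n : ℕ} {f : Store Γ n → Bool} (r : Finitary f) where

  verdict : State r ⊎ Bool → Maybe (Phase (State r))
  verdict (inj₁ x)     = just (inside x)
  verdict (inj₂ true)  = just accepted
  verdict (inj₂ false) = nothing

  advance : Phase (State r) → Symbol Γ → Maybe (Phase (State r))
  advance outside    ⟧ = just (inside (enter r))
  advance outside    _ = nothing
  advance accepted   _ = nothing
  advance (inside x) c = scan r x c Maybe.>>= verdict

  open Reversal (finite-Phase (finite-State r)) outside accepted advance

  Meaning : List (Symbol Γ) → Phase (State r) → Set
  Meaning w outside    = w ≡ []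
  Meaning w accepted   = ∃[ s ] word s ≡ w × f s ≡ true
  Meaning w (inside x) = Describes r x w

  trace-sound : ∀ w p → Trace w p → Meaning w p
  trace-sound []      _ refl = refl
  trace-sound (⟧ ∷ w) _ (outside , t , refl) with refl ← trace-sound w outside t =
    describes-enter r
  trace-sound (c ∷ w) p (inside x , t , eq) with scan r x c in eq′
  trace-sound (c ∷ w) p (inside x , t , refl) | just (inj₁ y) =
    scan-sound r x c (trace-sound w (inside x) t) eq′
  trace-sound (c ∷ w) p (inside x , t , refl) | just (inj₂ true) =
    scan-sound r x c (trace-sound w (inside x) t) eq′

  reads⇒trace : ∀ {w x} → Reads r w x → Trace w (inside x)
  reads⇒trace start         = outside , refl , refl
  reads⇒trace (next c R eq) = inside _ , reads⇒trace R , cong (Maybe._>>= verdict) eq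

  trace-complete : ∀ s → f s ≡ true → Trace (word s) accepted
  trace-complete s fs≡ with w , x , s≡ , R , eq ← scan-complete r s =
    subst (λ v → Trace v accepted) (sym s≡)
      (inside x , reads⇒trace R
      , trans (cong (Maybe._>>= verdict) eq) (cong (verdict ∘ inj₂) fs≡))

  finitary⇒regular : Regular (λ s → f s ≡ true)
  finitary⇒regular = automaton , λ w → mk⇔
    (λ acc → trace-sound w accepted (accepts⇒trace w acc))
    (λ { (s , refl , fs≡) → trace⇒accepts w (trace-complete s fs≡) })

recognisable⇒regular : ∀ {Γ n} {P : Pred (Store Γ n) 0ℓ} → Recognisable P → Regular P
recognisable⇒regular (recognised P? fin) with 𝒜 , rec ← finitary⇒regular fin =
  𝒜 , λ w → mk⇔
    (λ acc → let s , s≡ , true≡ = Equivalence.to (rec w) acc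
             in s , s≡ , T-does⁻ (P? s) (subst T (sym true≡) tt))
    (λ (s , s≡ , Ps) → Equivalence.from (rec w) (s , s≡ , Dec.dec-true (P? s) Ps))

-- Moves, organised by the order at which they act

module Moves {Γ : Set} (finite-Γ : Finite Γ) {N : ℕ} (Δ : List (Γ × Op Γ N)) where

  Has : (Op Γ N → Set) → Γ → Set
  Has C a = ∃[ o ] (a , o) ∈ˡ Δ × C o

  has? : ∀ {C : Op Γ N → Set} → (∀ o → Dec (C o)) → Decidable (Has C)
  has? C? a = map′
    (λ any → case find any of λ { ((_ , o) , ∈Δ , refl , c) → o , ∈Δ , c })
    (λ (o , ∈Δ , c) → lose ∈Δ (refl , c))
    (Any.any? (λ (b , o) → Finite._≟_ finite-Γ b a ×-dec C? o) Δ)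

  Rewrites : (List Γ → Set) → Op Γ N → Set
  Rewrites P (push₁ᵒ w)    = P w
  Rewrites P (pushᵒ _ _ _) = ⊥
  Rewrites P (popᵒ _ _ _)  = ⊥

  rewrites? : ∀ {P : List Γ → Set} → Decidable P → ∀ o → Dec (Rewrites P o)
  rewrites? P? (push₁ᵒ w)    = P? w
  rewrites? P? (pushᵒ _ _ _) = no λ ()
  rewrites? P? (popᵒ _ _ _)  = no λ ()

  IsPush IsPop : ℕ → Op Γ N → Set
  IsPush k (pushᵒ j _ _) = j ≡ k
  IsPush k _             = ⊥
  IsPop k (popᵒ j _ _) = j ≡ k
  IsPop k _            = ⊥

  isPush? : ∀ k o → Dec (IsPush k o)
  isPush? k (push₁ᵒ _)    = no λ ()
  isPush? k (pushᵒ j _ _) = j ≟ᴺ k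
  isPush? k (popᵒ _ _ _)  = no λ ()

  isPop? : ∀ k o → Dec (IsPop k o)
  isPop? k (push₁ᵒ _)    = no λ ()
  isPop? k (pushᵒ _ _ _) = no λ ()
  isPop? k (popᵒ j _ _)  = j ≟ᴺ k

  -- Here s is the top element of a store of order n + 2, and the operation acts on that larger
  -- store.
  CanPush CanPop : ∀ {n} → Pred (Store Γ (suc n)) 0ℓ
  CanPush {n} s = MaybeAny.Any (Has (IsPush (suc (suc n)))) (top₁ s)
  CanPop  {n} s = MaybeAny.Any (Has (IsPop (suc (suc n)))) (top₁ s)

  recognisable-CanPush : ∀ {n} → Recognisable (CanPush {n})
  recognisable-CanPush =
    recognisable-preimage (finitary-top₁ finite-Γ) (MaybeAny.dec (has? (isPush? _)))

  recognisable-CanPop : ∀ {n} → Recognisable (CanPop {n})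
  recognisable-CanPop =
    recognisable-preimage (finitary-top₁ finite-Γ) (MaybeAny.dec (has? (isPop? _)))

  -- Available at every order, although Δ has the fixed order N: a store of order n sees only the
  -- operations of order at most n. This permits induction on the order.
  data Move : ∀ {n} → Store Γ n → Store Γ n → Set where
    rewr : ∀ {a w as} → (a , push₁ᵒ w) ∈ˡ Δ → Move (base (a ∷ as)) (base (w ++ as))
    low  : ∀ {n} {s s′ : Store Γ (suc n)} {ss} → Move s s′ → Move (nest (s ∷ ss)) (nest (s′ ∷ ss))
    dup  : ∀ {n} {s : Store Γ (suc n)} {ss} → CanPush s → Move (nest (s ∷ ss)) (nest (s ∷ s ∷ ss))
    drop : ∀ {n} {s t : Store Γ (suc n)} {ss} → CanPop s →
           Move (nest (s ∷ t ∷ ss)) (nest (t ∷ ss))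

  Reach : ∀ {n} → Pred (Store Γ n) 0ℓ → Pred (Store Γ n) 0ℓ
  Reach P s = ∃[ t ] Star Move s t × P t

  reach-◅ : ∀ {n} {P : Pred (Store Γ n) 0ℓ} {s t} → Move s t → Reach P t → Reach P s
  reach-◅ m (u , ms , Pu) = u , m ◅ ms , Pu

  Next : ∀ {n} → Pred (Store Γ n) 0ℓ → Pred (Store Γ n) 0ℓ
  Next P s = ∃[ t ] Move s t × P t

  -- Predecessors and reachability at order 1

  module Order1 {P : Pred (Store Γ 1) 0ℓ} {Q : Set} (P? : Decidable P) (F : Finite Q)
    (run : List Γ → Q) (step : Q → Γ → Q) (run-∷ : ∀ a as → run (a ∷ as) ≡ step (run as) a)
    (out : Q → Bool) (P≡ : ∀ as → does (P? (base as)) ≡ out (run as)) where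

    run* : Q → List Γ → Q
    run* q []      = q
    run* q (a ∷ w) = step (run* q w) a

    run-++ : ∀ w as → run (w ++ as) ≡ run* (run as) w
    run-++ []      as = refl
    run-++ (a ∷ w) as = trans (run-∷ a (w ++ as)) (cong (λ q → step q a) (run-++ w as))

    out⇒P : ∀ as → T (out (run as)) → P (base as)
    out⇒P as t = T-does⁻ (P? (base as)) (subst T (sym (P≡ as)) t)

    P⇒out : ∀ as → P (base as) → T (out (run as))
    P⇒out as p = subst T (P≡ as) (T-does⁺ (P? (base as)) p)

    NextFrom : Q → Γ → Set
    NextFrom q a = Has (Rewrites (λ w → T (out (run* q w)))) a

    nextFrom? : ∀ q a → Dec (NextFrom q a)
    nextFrom? q a = has? (rewrites? (λ w → T? (out (run* q w)))) a

    next? : ∀ as → Dec (Next P (base as))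
    next? []       = no λ { (_ , () , _) }
    next? (a ∷ as) = map′
      (λ { (push₁ᵒ w , ∈Δ , acc) →
           base (w ++ as) , rewr ∈Δ , out⇒P (w ++ as) (subst (T ∘ out) (sym (run-++ w as)) acc) })
      (λ { (_ , rewr {w = w} ∈Δ , p) →
           push₁ᵒ w , ∈Δ , subst (T ∘ out) (run-++ w as) (P⇒out (w ++ as) p) })
      (nextFrom? (run as) a)

    -- The answer for a ∷ as depends only on a and on the state at as, so it can be carried along as
    -- a component of the state.
    recognisable-next : Recognisable (Next P)
    recognisable-next = recognised (λ { (base as) → next? as })
      (base (finite-× F finite-Bool) (λ as → run as , does (next? as))
        (λ (q , _) a → step q a , does (nextFrom? q a))
        (λ a as → cong₂ _,_ (run-∷ a as) refl) proj₂ (λ _ → refl))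

    -- An item (q , b , a) stands for the judgement: P can be reached from every
    -- a ∷ as with run as ≡ q, provided, if b is true, that it can be reached from as.
    Item : Set
    Item = Q × Bool × Γ

    -- Evaluates the judgements S along a word pushed above a list with state q: its top letter wins
    -- unaided, or wins given that everything below wins. At the end of the word, b speaks for the
    -- list.
    Eval : (Item → Set) → Q → Bool → List Γ → Set
    Eval S q b []      = T b
    Eval S q b (a ∷ w) = S (run* q w , false , a) ⊎ (S (run* q w , true , a) × Eval S q b w)

    -- Either P holds already, or some rewriting of a wins. Rewriting to the empty word is a pop,
    -- and then b decides.
    Rule : Pred Item 0ℓ → Pred Item 0ℓ
    Rule S (q , b , a) = T (out (step q a)) ⊎ Has (Rewrites (Eval S q b)) a

    eval-mono : ∀ {S S′ q b} → S ⊆ S′ → ∀ w → Eval S q b w → Eval S′ q b w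
    eval-mono S⊆S′ []      t                 = t
    eval-mono S⊆S′ (a ∷ w) (inj₁ s)          = inj₁ (S⊆S′ s)
    eval-mono S⊆S′ (a ∷ w) (inj₂ (s , e))    = inj₂ (S⊆S′ s , eval-mono S⊆S′ w e)

    eval? : ∀ {S} → Decidable S → ∀ q b w → Dec (Eval S q b w)
    eval? S? q b []      = T? b
    eval? S? q b (a ∷ w) = S? _ ⊎-dec (S? _ ×-dec eval? S? q b w)

    rule-mono : ∀ {S S′} → S ⊆ S′ → Rule S ⊆ Rule S′
    rule-mono S⊆S′ (inj₁ t)                    = inj₁ t
    rule-mono S⊆S′ (inj₂ (push₁ᵒ w , ∈Δ , e)) = inj₂ (push₁ᵒ w , ∈Δ , eval-mono S⊆S′ w e)

    rule? : ∀ {S} → Decidable S → Decidable (Rule S)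
    rule? S? (q , b , a) = T? (out (step q a)) ⊎-dec has? (rewrites? (eval? S? q b)) a

    finite-Item : Finite Item
    finite-Item = finite-× F (finite-× finite-Bool finite-Γ)

    open Saturation Rule rule-mono rule? (Finite._≟_ finite-Item)
    open Closure (saturate (elements finite-Item) {λ _ → ⊥} (λ _ → no λ ()))
      using ()
      renaming (carrier to Good; carrier? to good?; closed to good-closed; least to good-least)

    good : ∀ {i} → Rule Good i → Good i
    good {i} = good-closed (complete finite-Item i)

    -- An empty 1-store has no moves, so there only P itself counts; elsewhere one bit about the
    -- tail suffices.
    Wins : List Γ → Set
    Wins []       = T (out (run []))
    Wins (a ∷ as) = Good (run as , false , a) ⊎ (Good (run as , true , a) × Wins as)

    wins? : Decidable Wins
    wins? []       = T? (out (run []))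
    wins? (a ∷ as) = good? _ ⊎-dec (good? _ ×-dec wins? as)

    -- A win on the concatenation either is settled within w, or uses no more of as than the fact
    -- that it wins.
    wins-++ : ∀ w as → Wins (w ++ as) →
      Eval Good (run as) false w ⊎ (Eval Good (run as) true w × Wins as)
    wins-++ []      as win = inj₂ (tt , win)
    wins-++ (a ∷ w) as win rewrite run-++ w as with win
    ... | inj₁ g = inj₁ (inj₁ g)
    ... | inj₂ (g , win′) with wins-++ w as win′
    ...   | inj₁ e          = inj₁ (inj₂ (g , e))
    ...   | inj₂ (e , win″) = inj₂ (inj₂ (g , e) , win″)

    P⇒wins : ∀ as → P (base as) → Wins as
    P⇒wins []       p = P⇒out [] p
    P⇒wins (a ∷ as) p = inj₁ (good (inj₁ (subst (T ∘ out) (run-∷ a as) (P⇒out (a ∷ as) p))))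

    reach⇒wins : ∀ {as t} → Star Move (base as) t → P t → Wins as
    reach⇒wins ε p = P⇒wins _ p
    reach⇒wins (rewr {w = w} {as} ∈Δ ◅ ms) p with wins-++ w as (reach⇒wins ms p)
    ... | inj₁ e         = inj₁ (good (inj₂ (push₁ᵒ w , ∈Δ , e)))
    ... | inj₂ (e , win) = inj₂ (good (inj₂ (push₁ᵒ w , ∈Δ , e)) , win)

    -- The intended meaning of an item. It is closed under `Rule`, so leastness of `Good` gives
    -- soundness.
    Sound : Pred Item 0ℓ
    Sound (q , b , a) =
      ∀ as → run as ≡ q → (T b → Reach P (base as)) → Reach P (base (a ∷ as))

    eval-sound : ∀ {b} w as → Eval Sound (run as) b w → (T b → Reach P (base as)) →
      Reach P (base (w ++ as))
    eval-sound []      as t             r = r t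
    eval-sound (a ∷ w) as (inj₁ s)       r = s (w ++ as) (run-++ w as) λ ()
    eval-sound (a ∷ w) as (inj₂ (s , e)) r =
      s (w ++ as) (run-++ w as) (λ _ → eval-sound w as e r)

    rule-sound : Rule Sound ⊆ Sound
    rule-sound {_ , _ , a} (inj₁ t) as refl r =
      _ , ε , out⇒P (a ∷ as) (subst (T ∘ out) (sym (run-∷ a as)) t)
    rule-sound (inj₂ (push₁ᵒ w , ∈Δ , e)) as refl r =
      reach-◅ (rewr ∈Δ) (eval-sound w as e r)

    good-sound : Good ⊆ Sound
    good-sound = good-least (λ ()) rule-sound

    wins-sound : ∀ as → Wins as → Reach P (base as)
    wins-sound []       t             = base [] , ε , out⇒P [] t
    wins-sound (a ∷ as) (inj₁ g)       = good-sound g as refl λ ()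
    wins-sound (a ∷ as) (inj₂ (g , win)) = good-sound g as refl (λ _ → wins-sound as win)

    recognisable-reach : Recognisable (Reach P)
    recognisable-reach = recognised
      (λ { (base as) → map′ (wins-sound as) (λ (_ , ms , p) → reach⇒wins ms p) (wins? as) })
      (base (finite-× F finite-Bool) (λ as → run as , does (wins? as))
        (λ (q , b) a → step q a ,
          (does (good? (q , false , a)) ∨ (does (good? (q , true , a)) ∧ b)))
        (λ a as → cong₂ _,_ (run-∷ a as) refl) proj₂ (λ _ → refl))

  -- Alternation of lower-order runs and pushes

  module Chains {n : ℕ} {Q : Set} (_≟_ : DecidableEquality Q) (step : Q → Store Γ (suc n) → Q)
    where

    -- Chain U F q s: from s, alternate runs of moves with pushes that change the
    -- state from q to a member of U, and finish in F. Two visits of one state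
    -- can be merged, because the pushes between them can be skipped; hence one
    -- may assume that the first element of U is visited at most once.
    Chain : List Q → (Q → Pred (Store Γ (suc n)) 0ℓ) → Q → Pred (Store Γ (suc n)) 0ℓ
    Via : Q → Pred (Store Γ (suc n)) 0ℓ → (Q → Pred (Store Γ (suc n)) 0ℓ) →
      Q → Pred (Store Γ (suc n)) 0ℓ
    Chain []      F q = Reach (F q)
    Chain (x ∷ U) F   = Chain U (Via x (Chain U F x) F)
    Via x P F q s = F q s ⊎ (CanPush s × step q s ≡ x × P s)

    chain-stop : ∀ U {F q s} → F q s → Chain U F q s
    chain-stop []      f = _ , ε , f
    chain-stop (x ∷ U) f = chain-stop U (inj₁ f)

    chain-◅◅ : ∀ U {F q s t} → Star Move s t → Chain U F q t → Chain U F q s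
    chain-◅◅ []      ms (u , ms′ , f) = u , ms ◅◅ ms′ , f
    chain-◅◅ (x ∷ U) ms c             = chain-◅◅ U ms c

    -- An induction principle that hides the recursion on U: each `Via` layer is discharged by the
    -- push hypothesis, after the chain inside it has been treated by induction.
    chain-least : ∀ U {F} {P : Q → Pred (Store Γ (suc n)) 0ℓ} →
      (∀ {q} → F q ⊆ P q) → (∀ {q s t} → Star Move s t → P q t → P q s) →
      (∀ {q s} → CanPush s → step q s ∈ˡ U → P (step q s) s → P q s) →
      ∀ {q} → Chain U F q ⊆ P q
    chain-least []      F⊆P closed push (u , ms , f) = closed ms (F⊆P f)
    chain-least (x ∷ U) F⊆P closed push =
      chain-least U
        (λ { (inj₁ f) → F⊆P f
           ; (inj₂ (can , refl , c)) →
               push can (here refl) (chain-least U F⊆P closed (λ can → push can ∘ there) c) })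
        closed (λ can → push can ∘ there)

    -- A push leaves the top element s unchanged and alters only q. If the chain returns to x after
    -- the push, `bypass` keeps the moves made before the return and drops the pushes among them.
    chain-push : ∀ U {F q s} → CanPush s → step q s ∈ˡ U → Chain U F (step q s) s → Chain U F q s
    chain-push (x ∷ U)     can (there ∈U)  c = chain-push U can ∈U c
    chain-push (x ∷ U) {F} can (here refl) c =
      -- `bypass` is used at state x, where both of its outcomes are chains from x through U alone.
      chain-stop U (inj₂ (can , refl , [ id , id ]′ (bypass c)))
      where
      bypass : ∀ {q} → Chain U (Via x (Chain U F x) F) q ⊆ λ s → Chain U F q s ⊎ Chain U F x s
      bypass = chain-least U
        (λ { (inj₁ f) → inj₁ (chain-stop U f) ; (inj₂ (_ , _ , c)) → inj₂ c })
        (λ ms → Sum.map (chain-◅◅ U ms) (chain-◅◅ U ms))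
        (λ can ∈U → Sum.map₁ (chain-push U can ∈U))

    -- F is general because each state taken from U is absorbed into it. Reachability of the lower
    -- order is invoked only once U is exhausted.
    recognisable-chain : (∀ q → Finitary (step q)) →
      (∀ {P : Pred (Store Γ (suc n)) 0ℓ} → Recognisable P → Recognisable (Reach P)) →
      ∀ U {F} → (∀ q → Recognisable (F q)) → ∀ q → Recognisable (Chain U F q)
    recognisable-chain fin reach []      rec q = reach (rec q)
    recognisable-chain fin reach (x ∷ U) rec   = recognisable-chain fin reach U λ q →
      recognisable-∪ (rec q)
        (recognisable-∩ recognisable-CanPush
          (recognisable-∩ (recognisable-preimage (fin q) (_≟ x))
            (recognisable-chain fin reach U rec x)))

  -- Predecessors and reachability at order n + 2

  module OrderSuc {n : ℕ} {P : Pred (Store Γ (suc (suc n))) 0ℓ} {Q : Set} (P? : Decidable P)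
    (F : Finite Q) (run : List (Store Γ (suc n)) → Q) (step : Q → Store Γ (suc n) → Q)
    (run-∷ : ∀ s ss → run (s ∷ ss) ≡ step (run ss) s) (fin : ∀ q → Finitary (step q))
    (out : Q → Bool) (P≡ : ∀ s ss → does (P? (nest (s ∷ ss))) ≡ out (run (s ∷ ss))) where

    Final : Q → Pred (Store Γ (suc n)) 0ℓ
    Final q s = T (out (step q s))

    recognisable-Final : ∀ q → Recognisable (Final q)
    recognisable-Final q = recognisable-preimage (fin q) (T? ∘ out)

    final⇒P : ∀ s ss → Final (run ss) s → P (nest (s ∷ ss))
    final⇒P s ss t =
      T-does⁻ (P? _) (subst T (sym (trans (P≡ s ss) (cong out (run-∷ s ss)))) t)

    P⇒final : ∀ s ss → P (nest (s ∷ ss)) → Final (run ss) s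
    P⇒final s ss p = subst T (trans (P≡ s ss) (cong out (run-∷ s ss))) (T-does⁺ (P? _) p)

    module _
      (next : ∀ {P : Pred (Store Γ (suc n)) 0ℓ} → Recognisable P → Recognisable (Next P)) where

      -- The successors that do not uncover the tail. Naming the new state p lets recognisability be
      -- shown for each fixed p, followed by a finite union.
      Stay : Q → Pred (Store Γ (suc n)) 0ℓ
      Stay q s = Next (Final q) s ⊎ (CanPush s × (∃[ p ] step q s ≡ p × Final p s))

      recognisable-Stay : ∀ q → Recognisable (Stay q)
      recognisable-Stay q = recognisable-∪ (next (recognisable-Final q))
        (recognisable-∩ recognisable-CanPush
          (recognisable-∃ F λ p →
            recognisable-∩ (recognisable-preimage (fin q) (λ p′ → Finite._≟_ F p′ p))
              (recognisable-Final p)))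

      Tail Nexts : List (Store Γ (suc n)) → Set
      Tail []        = ⊥
      Tail (s ∷ ss)  = P (nest (s ∷ ss))
      Nexts []       = ⊥
      Nexts (s ∷ ss) = Stay (run ss) s ⊎ (CanPop s × Tail ss)

      tail? : Decidable Tail
      tail? []       = no λ ()
      tail? (s ∷ ss) = P? (nest (s ∷ ss))

      nexts? : Decidable Nexts
      nexts? []       = no λ ()
      nexts? (s ∷ ss) = decide (recognisable-Stay (run ss)) s
        ⊎-dec (decide recognisable-CanPop s ×-dec tail? ss)

      nexts⇒next : ∀ {s ss} → Nexts (s ∷ ss) → Next P (nest (s ∷ ss))
      nexts⇒next {ss = ss} (inj₁ (inj₁ (t , m , f))) = _ , low m , final⇒P t ss f
      nexts⇒next {s} {ss} (inj₁ (inj₂ (can , _ , refl , f))) =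
        _ , dup can , final⇒P s (s ∷ ss) (subst (λ q → Final q s) (sym (run-∷ s ss)) f)
      nexts⇒next {ss = _ ∷ _} (inj₂ (can , p)) = _ , drop can , p

      next⇒nexts : ∀ {s ss} → Next P (nest (s ∷ ss)) → Nexts (s ∷ ss)
      next⇒nexts {ss = ss} (_ , low {s′ = t} m , p) = inj₁ (inj₁ (t , m , P⇒final t ss p))
      next⇒nexts {s} {ss} (_ , dup can , p) =
        inj₁ (inj₂ (can , _ , refl , subst (λ q → Final q s) (run-∷ s ss) (P⇒final s (s ∷ ss) p)))
      next⇒nexts (_ , drop can , p) = inj₂ (can , p)

      recognisable-next : Recognisable (Next P)
      recognisable-next = recognised
        (λ { (nest (s ∷ ss)) → map′ nexts⇒next next⇒nexts (nexts? (s ∷ ss)) })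
        (nest (finite-× F (finite-× finite-Bool finite-Bool))
          -- The middle bit records P on the current list; the next step needs it for the outcome of
          -- a pop.
          (λ ss → run ss , does (tail? ss) , does (nexts? ss))
          (λ (q , b , _) s → step q s , out (step q s) ,
            (does (decide (recognisable-Stay q) s) ∨ (does (decide recognisable-CanPop s) ∧ b)))
          (λ s ss → cong₂ _,_ (run-∷ s ss)
            (cong₂ _,_ (trans (P≡ s ss) (cong out (run-∷ s ss))) refl))
          (λ (q , b , _) → finitary-, (fin q) (finitary-, (finitary-∘ out (fin q))
            (finitary-∘ (λ (x , y) → x ∨ (y ∧ b))
              (finitary-, (finitary (recognisable-Stay q)) (finitary recognisable-CanPop)))))
          (λ (_ , _ , b) → b) (λ _ _ → refl))

    open Chains (Finite._≟_ F) step

    module _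
      (reach : ∀ {P : Pred (Store Γ (suc n)) 0ℓ} → Recognisable P → Recognisable (Reach P)) where

      -- P is reached from s above a list with state q by pushes and by moves inside the top
      -- element, so that list is never uncovered.
      Live : Q → Pred (Store Γ (suc n)) 0ℓ
      Live = Chain (elements F) Final

      recognisable-Live : ∀ q → Recognisable (Live q)
      recognisable-Live = recognisable-chain fin reach (elements F) recognisable-Final

      -- A push whose copy is popped again has no effect; so an element can be
      -- popped iff moves inside it lead to a store on which pop applies.
      recognisable-Popped : Recognisable (Reach CanPop)
      recognisable-Popped = reach recognisable-CanPop

      Wins : List (Store Γ (suc n)) → Set
      Wins []       = ⊥
      Wins (s ∷ ss) = Live (run ss) s ⊎ (Reach CanPop s × Wins ss)

      wins? : Decidable Wins
      wins? []       = no λ ()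
      wins? (s ∷ ss) = decide (recognisable-Live (run ss)) s
        ⊎-dec (decide recognisable-Popped s ×-dec wins? ss)

      reach⇒wins : ∀ {s ss t} → Star Move (nest (s ∷ ss)) t → P t → Wins (s ∷ ss)
      reach⇒wins {s} {ss} ε p = inj₁ (chain-stop (elements F) (P⇒final s ss p))
      reach⇒wins (low m ◅ ms) p with reach⇒wins ms p
      ... | inj₁ live                     = inj₁ (chain-◅◅ (elements F) (m ◅ ε) live)
      ... | inj₂ (popped , win)           = inj₂ (reach-◅ m popped , win)
      reach⇒wins {s} {ss} (dup can ◅ ms) p with reach⇒wins ms p
      ... | inj₁ live      = inj₁ (chain-push (elements F) can (complete F _)
                                     (subst (λ q → Live q s) (run-∷ s ss) live))
      ... | inj₂ (_ , win) = win
      -- The pop applies to s at once, so the run inside it is empty.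
      reach⇒wins {s} (drop can ◅ ms) p = inj₂ ((s , ε , can) , reach⇒wins ms p)

      star-low : ∀ {s t : Store Γ (suc n)} {ss} → Star Move s t →
        Star Move (nest (s ∷ ss)) (nest (t ∷ ss))
      star-low = gmap (λ s → nest (s ∷ _)) low

      reach-◅◅ : ∀ {s t} → Star Move s t → Reach P t → Reach P s
      reach-◅◅ ms (u , ms′ , p) = u , ms ◅◅ ms′ , p

      -- The list below is quantified within the predicate because every push lengthens it.
      live-sound : ∀ {q s} → Live q s → ∀ ss → run ss ≡ q → Reach P (nest (s ∷ ss))
      live-sound = chain-least (elements F)
        {P = λ q s → ∀ ss → run ss ≡ q → Reach P (nest (s ∷ ss))}
        (λ { {x = s} f ss refl → _ , ε , final⇒P s ss f })
        (λ ms r ss eq → reach-◅◅ (star-low ms) (r ss eq))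
        (λ { {s = s} can _ r ss refl → reach-◅ (dup can) (r (s ∷ ss) (run-∷ s ss)) })

      wins-sound : ∀ {s ss} → Wins (s ∷ ss) → Reach P (nest (s ∷ ss))
      wins-sound {ss = ss} (inj₁ live) = live-sound live ss refl
      wins-sound {ss = _ ∷ _} (inj₂ ((t , ms , can) , win)) =
        reach-◅◅ (star-low ms) (reach-◅ (drop can) (wins-sound win))

      recognisable-reach : Recognisable (Reach P)
      recognisable-reach = recognised
        (λ { (nest (s ∷ ss)) →
          map′ wins-sound (λ (_ , ms , p) → reach⇒wins ms p) (wins? (s ∷ ss)) })
        (nest (finite-× F finite-Bool) (λ ss → run ss , does (wins? ss))
          (λ (q , b) s → step q s ,
            (does (decide (recognisable-Live q) s) ∨ (does (decide recognisable-Popped s) ∧ b)))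
          (λ s ss → cong₂ _,_ (run-∷ s ss) refl)
          (λ (q , b) → finitary-, (fin q) (finitary-∘ (λ (x , y) → x ∨ (y ∧ b))
            (finitary-, (finitary (recognisable-Live q)) (finitary recognisable-Popped))))
          proj₂ (λ _ _ → refl))

  recognisable-next : ∀ n {P : Pred (Store Γ (suc n)) 0ℓ} →
    Recognisable P → Recognisable (Next P)
  recognisable-next zero (recognised P? (base F run step run-∷ out P≡)) =
    Order1.recognisable-next P? F run step run-∷ out P≡
  recognisable-next (suc n) (recognised P? (nest F run step run-∷ fin out P≡)) =
    OrderSuc.recognisable-next P? F run step run-∷ fin out P≡ (recognisable-next n)

  recognisable-reach : ∀ n {P : Pred (Store Γ (suc n)) 0ℓ} →
    Recognisable P → Recognisable (Reach P)
  recognisable-reach zero (recognised P? (base F run step run-∷ out P≡)) =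
    Order1.recognisable-reach P? F run step run-∷ out P≡
  recognisable-reach (suc n) (recognised P? (nest F run step run-∷ fin out P≡)) =
    OrderSuc.recognisable-reach P? F run step run-∷ fin out P≡ (recognisable-reach n)

  -- Agreement of moves with the operations, applied at every order

  applyAt : ∀ {m} → Op Γ N → Store Γ m → Maybe (Store Γ m)
  applyAt (push₁ᵒ w)    = push₁ w
  applyAt (pushᵒ k _ _) = push k
  applyAt (popᵒ k _ _)  = pop k

  apply≡applyAt : ∀ o (s : Store Γ N) → apply o s ≡ applyAt o s
  apply≡applyAt (push₁ᵒ w)    s = refl
  apply≡applyAt (pushᵒ k _ _) s = refl
  apply≡applyAt (popᵒ k _ _)  s = refl

  canDo : ∀ {C : Op Γ N → Set} {m : Maybe Γ} {a o} → m ≡ just a → (a , o) ∈ˡ Δ → C o →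
    MaybeAny.Any (Has C) m
  canDo refl ∈Δ c = MaybeAny.just (_ , ∈Δ , c)

  apply⇒move : ∀ {m} o (s : Store Γ m) {a t} → (a , o) ∈ˡ Δ → top₁ s ≡ just a →
    applyAt o s ≡ just t → Move s t
  apply⇒move (push₁ᵒ w) (base (a ∷ as)) ∈Δ refl refl = rewr ∈Δ
  apply⇒move o@(push₁ᵒ w) (nest (s ∷ ss)) ∈Δ top eq with push₁ w s in eq′
  apply⇒move o@(push₁ᵒ w) (nest (s ∷ ss)) ∈Δ top refl | just t =
    low (apply⇒move o s ∈Δ top eq′)
  apply⇒move {m} o@(pushᵒ k _ _) (nest (s ∷ ss)) ∈Δ top eq with k ≟ᴺ m
  apply⇒move o@(pushᵒ k _ _) (nest (s ∷ ss)) ∈Δ top refl | yes k≡m = dup (canDo top ∈Δ k≡m)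
  ... | no _ with push k s in eq′
  apply⇒move o@(pushᵒ k _ _) (nest (s ∷ ss)) ∈Δ top refl | no _ | just t =
    low (apply⇒move o s ∈Δ top eq′)
  apply⇒move {m} o@(popᵒ k _ _) (nest (s ∷ ss)) ∈Δ top eq with k ≟ᴺ m
  apply⇒move o@(popᵒ k _ _) (nest (s ∷ _ ∷ ss)) ∈Δ top refl | yes k≡m = drop (canDo top ∈Δ k≡m)
  ... | no _ with pop k s in eq′
  apply⇒move o@(popᵒ k _ _) (nest (s ∷ ss)) ∈Δ top refl | no _ | just t =
    low (apply⇒move o s ∈Δ top eq′)

  ActsBelow : ℕ → Op Γ N → Set
  ActsBelow m (push₁ᵒ _)    = ⊤
  ActsBelow m (pushᵒ k _ _) = k ≤ m
  ActsBelow m (popᵒ k _ _)  = k ≤ m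

  actsBelow-suc : ∀ {m} o → ActsBelow m o → ActsBelow (suc m) o
  actsBelow-suc (push₁ᵒ _)    _   = tt
  actsBelow-suc (pushᵒ _ _ _) k≤m = m≤n⇒m≤1+n k≤m
  actsBelow-suc (popᵒ _ _ _)  k≤m = m≤n⇒m≤1+n k≤m

  -- The bound on the order of o rules out its acting on the enclosing store, so it passes through
  -- to the top element.
  applyAt-nest : ∀ {m} o {s t : Store Γ (suc m)} {ss} → ActsBelow (suc m) o →
    applyAt o s ≡ just t → applyAt o (nest (s ∷ ss)) ≡ just (nest (t ∷ ss))
  applyAt-nest (push₁ᵒ w) _ eq = cong (Maybe.map _) eq
  applyAt-nest {m} (pushᵒ k _ _) k≤ eq with k ≟ᴺ suc (suc m)
  ... | yes refl = ⊥-elim (1+n≰n k≤)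
  ... | no _     = cong (Maybe.map _) eq
  applyAt-nest {m} (popᵒ k _ _) k≤ eq with k ≟ᴺ suc (suc m)
  ... | yes refl = ⊥-elim (1+n≰n k≤)
  ... | no _     = cong (Maybe.map _) eq

  push-dup : ∀ {m} (s : Store Γ (suc m)) ss →
    push (suc (suc m)) (nest (s ∷ ss)) ≡ just (nest (s ∷ s ∷ ss))
  push-dup {m} s ss with suc (suc m) ≟ᴺ suc (suc m)
  ... | yes _   = refl
  ... | no  k≢k = ⊥-elim (k≢k refl)

  pop-drop : ∀ {m} (s t : Store Γ (suc m)) ss →
    pop (suc (suc m)) (nest (s ∷ t ∷ ss)) ≡ just (nest (t ∷ ss))
  pop-drop {m} s t ss with suc (suc m) ≟ᴺ suc (suc m)
  ... | yes _   = refl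
  ... | no  k≢k = ⊥-elim (k≢k refl)

  move⇒apply : ∀ {m} {s t : Store Γ m} → Move s t →
    ∃[ a ] ∃[ o ] (a , o) ∈ˡ Δ × top₁ s ≡ just a × applyAt o s ≡ just t × ActsBelow m o
  move⇒apply (rewr {a} {w} ∈Δ) = a , push₁ᵒ w , ∈Δ , refl , refl , tt
  move⇒apply {suc _} (low m) with a , o , ∈Δ , top , eq , below ← move⇒apply m =
    a , o , ∈Δ , top , applyAt-nest o below eq , actsBelow-suc o below
  move⇒apply (dup {s = s} {ss} can) with top₁ s
  move⇒apply (dup {s = s} {ss} (MaybeAny.just (o@(pushᵒ _ _ _) , ∈Δ , refl))) | just a =
    a , o , ∈Δ , refl , push-dup s ss , ≤-refl
  move⇒apply (drop {s = s} {t} {ss} can) with top₁ s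
  move⇒apply (drop {s = s} {t} {ss} (MaybeAny.just (o@(popᵒ _ _ _) , ∈Δ , refl))) | just a =
    a , o , ∈Δ , refl , pop-drop s t ss , ≤-refl

-- Satisfaction sets of formulas

module _ {Γ : Set} (finite-Γ : Finite Γ) {n : ℕ} (H : HCFP Γ (suc n)) where
  open HCFP H
  open Moves finite-Γ Δ

  step⇒move : ∀ {s t} → Step H s t → Move s t
  step⇒move {s} (a , o , ∈Δ , top , eq) =
    apply⇒move o s ∈Δ top (trans (sym (apply≡applyAt o s)) eq)

  move⇒step : ∀ {s t} → Move s t → Step H s t
  move⇒step {s} m with a , o , ∈Δ , top , eq , _ ← move⇒apply m =
    a , o , ∈Δ , top , trans (apply≡applyAt o s) eq

  recognisable-⊨ : ∀ φ → Recognisable (λ s → H , s ⊨ φ)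
  recognisable-⊨ (atom R)  = recognisable-accepts (RegularSet.automaton R)
  recognisable-⊨ (not φ)   = recognisable-∁ (recognisable-⊨ φ)
  recognisable-⊨ (φ and ψ) = recognisable-∩ (recognisable-⊨ φ) (recognisable-⊨ ψ)
  recognisable-⊨ (EX φ)    = recognisable-⇔
    (λ (t , m , p) → t , move⇒step m , p) (λ (t , m , p) → t , step⇒move m , p)
    (recognisable-next n (recognisable-⊨ φ))
  recognisable-⊨ (EF φ)    = recognisable-⇔
    (λ (t , ms , p) → t , Star.map move⇒step ms , p)
    (λ (t , ms , p) → t , Star.map step⇒move ms , p)
    (recognisable-reach n (recognisable-⊨ φ))

theorem2 : {Γ : Set} {m : ℕ} → Γ ↔ Fin m →
    (n : ℕ) → 1 ≤ n → (H : HCFP Γ n) (φ : Formula Γ n) →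
    Regular (λ s → H , s ⊨ φ)
theorem2 Γ↔m (suc n) _ H φ = recognisable⇒regular (recognisable-⊨ (finite-↔ Γ↔m) H φ)
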